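{- Let $\mathscr{A}$, $(\mathcal{E},\mathcal{M})$, $\mathscr{A}_0$, $\Lambda$, $\mathscr{X}$ be data satisfying the standing assumptions listed in the context. The deduction system for semantic entailment consisting of the rules (Weakening) and (Substitution) is sound and complete: for every pair of equations $\mathscr{T}_X$ over $X\in\mathscr{X}$ and $\mathscr{T}'_Y$ over $Y\in\mathscr{X}$, $$\mathscr{T}_X\models\mathscr{T}'_Y\quad\text{iff}\quad \mathscr{T}_X\vdash\mathscr{T}'_Y.$$
   Context: A factorization system $(\mathcal{E},\mathcal{M})$ in a category consists of two classes of morphisms, both containing all isomorphisms and closed under composition, such that every morphism $f$ factorizes as $f=m\cdot e$ with $e\in\mathcal{E}$ (the coimage of $f$), $m\in\mathcal{M}$ (the image of $f$), and the unique diagonal fill-in property holds. It is proper if all $\mathcal{E}$-morphisms are epic and all $\mathcal{M}$-morphisms are monic. Fix a category $\mathscr{A}$ with a proper factorization system $(\mathcal{E},\mathcal{M})$, a full subcategory $\mathscr{A}_0\subseteq\mathscr{A}$, a class $\Lambda$ of cardinal numbers and a class $\mathscr{X}$ of objects of $\mathscr{A}$. A quotient of $X$ is represented by an $\mathcal{E}$-morphism with domain $X$; quotients of $X$ are ordered by $e\leq e'$ iff $e'=h\cdot e$ for some $h$, and isomorphic quotients are identified. $X{\downarrow}\mathscr{A}_0$ denotes the class of quotients of $X$ with codomain in $\mathscr{A}_0$. An object $X$ is projective w.r.t. $e\colon A\to B$ if every $h\colon X\to B$ is of the form $e\cdot g$ for some $g\colon X\to A$. Put $\mathcal{E}_{\mathscr{X}}=\{e\in\mathcal{E}: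 \text{every } X\in\mathscr{X} \text{ is projective w.r.t. } e\}$. An object is $\mathscr{X}$-generated if it is a quotient of an object of $\mathscr{X}$. Standing assumptions: (1) $\mathscr{A}$ has $\Lambda$-products, i.e. products of families $(A_i)_{i<\lambda}$ with $\lambda\in\Lambda$. (2) $\mathscr{A}_0$ is closed under isomorphisms, $\Lambda$-products and $\mathscr{X}$-generated subobjects (if $m\colon A\to B$ is in $\mathcal{M}$, $B\in\mathscr{A}_0$ and $A$ is $\mathscr{X}$-generated, then $A\in\mathscr{A}_0$). (3) For every $A\in\mathscr{A}_0$ there is some $e\colon X\to A$ in $\mathcal{E}_{\mathscr{X}}$ with $X\in\mathscr{X}$. An equation over $X\in\mathscr{X}$ is a class $\mathscr{T}_X\subseteq X{\downarrow}\mathscr{A}_0$ that is (i) $\Lambda$-codirected: every family $(e_i)_{i<\lambda}$ in $\mathscr{T}_X$ with $\lambda\in\Lambda$ has a lower bound in $\mathscr{T}_X$; (ii) closed under $\mathcal{E}_{\mathscr{X}}$-quotients: for $e\colon X\to E$ in $\mathscr{T}_X$ and $q\colon E\to E'$ in $\mathcal{E}_{\mathscr{X}}$ with $E'\in\mathscr{A}_0$, one has $q\cdot e\in\mathscr{T}_X$. An object $A$ satisfies $\mathscr{T}_X$ (written $A\models\mathscr{T}_X$) if every $h\colon X\to A$ factorizes through some $e\in\mathscr{T}_X$. An equational theory is a family of equations $\mathscr{T}=(\mathscr{T}_X\subseteq X{\downarrow}\mathscr{A}_0)_{X\in\mathscr{X}}$ with: (substitution invariance) for every $h\colon X\to Y$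 with $X,Y\in\mathscr{X}$ and every $e_Y\in\mathscr{T}_Y$, the coimage of $e_Y\cdot h$ lies in $\mathscr{T}_X$; ($\mathcal{E}_{\mathscr{X}}$-completeness) for every $Y\in\mathscr{X}$ and $e\colon Y\to E_Y$ in $\mathscr{T}_Y$ there exist $X\in\mathscr{X}$ and $e_X\colon X\to E_X$ in $\mathscr{T}_X\cap\mathcal{E}_{\mathscr{X}}$ with $E_X=E_Y$. For equations over $X$ put $\mathscr{T}_X\leq\mathscr{T}'_X$ iff every quotient in $\mathscr{T}'_X$ factorizes through some quotient in $\mathscr{T}_X$; for theories, $\mathscr{T}\leq\mathscr{T}'$ iff $\mathscr{T}_X\leq\mathscr{T}'_X$ for all $X\in\mathscr{X}$. The substitution closure of an equation $\mathscr{T}_X$ over $X$ is the smallest theory $\overline{\mathscr{T}}=(\overline{\mathscr{T}}_Y)_{Y\in\mathscr{X}}$ (w.r.t. $\leq$) such that $\mathscr{T}_X\leq\overline{\mathscr{T}}_X$ (it exists). Semantic entailment: $\mathscr{T}_X\models\mathscr{T}'_Y$ if every object of $\mathscr{A}_0$ satisfying $\mathscr{T}_X$ also satisfies $\mathscr{T}'_Y$. Deduction system: (Weakening) $\mathscr{T}_X\vdash\mathscr{T}'_X$ for all equations $\mathscr{T}'_X\leq\mathscr{T}_X$ over $X\in\mathscr{X}$. (Substitution) $\mathscr{T}_X\vdash\overline{\mathscr{T}}_Y$ for all equations $\mathscr{T}_X$ over $X\in\mathscr{X}$ and all $Y\in\mathscr{X}$. One writes $\mathscr{T}_X\vdash\mathscr{T}'_Y$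 if $\mathscr{T}'_Y$ arises from $\mathscr{T}_X$ by a finite chain of applications of these rules. -}

module Defs where

open import Level using (Level; _⊔_) renaming (suc to lsuc)
open import Data.Product using (Σ; Σ-syntax; _×_; _,_; proj₁)
open import Function.Bundles using (_↔_)
open import Relation.Binary.Core using (Rel)
open import Relation.Binary.Structures using (IsEquivalence)
open import Relation.Binary.Construct.Closure.ReflexiveTransitive using (Star)
open import Relation.Unary using (Pred; _∈_)

-- Morphisms between two objects form a setoid under _≈_; objects carry no
-- equality besides the ambient propositional one.
record Category (o ℓ e : Level) : Set (lsuc (o ⊔ ℓ ⊔ e)) where
  infix  4 _≈_ _⇒_
  infixr 9 _∘_
  field
    Obj       : Set o
    _⇒_       : Obj → Obj → Set ℓ
    _≈_       : ∀ {A B} → Rel (A ⇒ B) e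
    id        : ∀ {A} → A ⇒ A
    _∘_       : ∀ {A B C} → B ⇒ C → A ⇒ B → A ⇒ C
    equiv     : ∀ {A B} → IsEquivalence (_≈_ {A} {B})
    ∘-resp-≈  : ∀ {A B C} {f f′ : B ⇒ C} {g g′ : A ⇒ B} →
                f ≈ f′ → g ≈ g′ → f ∘ g ≈ f′ ∘ g′
    assoc     : ∀ {A B C D} {f : A ⇒ B} {g : B ⇒ C} {h : C ⇒ D} →
                (h ∘ g) ∘ f ≈ h ∘ (g ∘ f)
    identityˡ : ∀ {A B} {f : A ⇒ B} → id ∘ f ≈ f
    identityʳ : ∀ {A B} {f : A ⇒ B} → f ∘ id ≈ f

  IsIso : ∀ {A B} → A ⇒ B → Set (ℓ ⊔ e)
  IsIso {A} {B} f = Σ[ g ∈ B ⇒ A ] (g ∘ f ≈ id) × (f ∘ g ≈ id)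

  Epic : ∀ {A B} → A ⇒ B → Set (o ⊔ ℓ ⊔ e)
  Epic {A} {B} f = ∀ {C} (g h : B ⇒ C) → g ∘ f ≈ h ∘ f → g ≈ h

  Monic : ∀ {A B} → A ⇒ B → Set (o ⊔ ℓ ⊔ e)
  Monic {A} {B} f = ∀ {C} (g h : C ⇒ A) → f ∘ g ≈ f ∘ h → g ≈ h

  _FactorsThrough_ : ∀ {X A B} → X ⇒ B → X ⇒ A → Set (ℓ ⊔ e)
  _FactorsThrough_ {X} {A} {B} f g = Σ[ h ∈ A ⇒ B ] f ≈ h ∘ g

  IsProduct : ∀ {ι} {I : Set ι} (A : I → Obj) (P : Obj) →
              (∀ i → P ⇒ A i) → Set (o ⊔ ℓ ⊔ e ⊔ ι)
  IsProduct A P π = ∀ {C} (f : ∀ i → C ⇒ A i) →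
    Σ[ u ∈ C ⇒ P ] (∀ i → π i ∘ u ≈ f i) ×
                   (∀ (v : C ⇒ P) → (∀ i → π i ∘ v ≈ f i) → v ≈ u)

  IsProjective : Obj → ∀ {A B} → A ⇒ B → Set (ℓ ⊔ e)
  IsProjective X {A} {B} e = ∀ (h : X ⇒ B) → Σ[ g ∈ X ⇒ A ] h ≈ e ∘ g

record ProperFactorizationSystem {o ℓ e} (𝒜 : Category o ℓ e) (c : Level) :
       Set (o ⊔ ℓ ⊔ e ⊔ lsuc c) where
  open Category 𝒜
  field
    ℰ ℳ      : ∀ {A B} → Pred (A ⇒ B) c
    ℰ-resp-≈ : ∀ {A B} {f g : A ⇒ B} → f ≈ g → f ∈ ℰ → g ∈ ℰ
    ℳ-resp-≈ : ∀ {A B} {f g : A ⇒ B} → f ≈ g → f ∈ ℳ → g ∈ ℳ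
    ℰ-iso    : ∀ {A B} {f : A ⇒ B} → IsIso f → f ∈ ℰ
    ℳ-iso    : ∀ {A B} {f : A ⇒ B} → IsIso f → f ∈ ℳ
    ℰ-∘      : ∀ {A B C} {g : B ⇒ C} {f : A ⇒ B} → g ∈ ℰ → f ∈ ℰ → g ∘ f ∈ ℰ
    ℳ-∘      : ∀ {A B C} {g : B ⇒ C} {f : A ⇒ B} → g ∈ ℳ → f ∈ ℳ → g ∘ f ∈ ℳ

  IsCoimage : ∀ {A B C} → A ⇒ B → A ⇒ C → Set (ℓ ⊔ e ⊔ c)
  IsCoimage {A} {B} {C} f q = q ∈ ℰ × (Σ[ m ∈ C ⇒ B ] m ∈ ℳ × f ≈ m ∘ q)

  field
    factorize : ∀ {A B} (f : A ⇒ B) → Σ[ C ∈ Obj ] Σ[ q ∈ A ⇒ C ] IsCoimage f q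
    diagonal  : ∀ {A B C D} {q : A ⇒ B} {f : A ⇒ C} {g : B ⇒ D} {m : C ⇒ D} →
                q ∈ ℰ → m ∈ ℳ → g ∘ q ≈ m ∘ f →
                Σ[ d ∈ B ⇒ C ] ((d ∘ q ≈ f) × (m ∘ d ≈ g)) ×
                  (∀ (d′ : B ⇒ C) → d′ ∘ q ≈ f → m ∘ d′ ≈ g → d′ ≈ d)
    ℰ-epic    : ∀ {A B} {f : A ⇒ B} → f ∈ ℰ → Epic f
    ℳ-monic   : ∀ {A B} {f : A ⇒ B} → f ∈ ℳ → Monic f

-- A cardinal number is a set up to bijection, so a class of cardinal numbers
-- is a bijection-invariant class of (index) sets.
record CardinalClass (ι c : Level) : Set (lsuc (ι ⊔ c)) where
  field
    Card      : Pred (Set ι) c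
    invariant : ∀ {I J : Set ι} → I ↔ J → I ∈ Card → J ∈ Card

-- Classes are predicates in a universe that contains o, ℓ and e, so that they
-- may be defined by quantifying over the objects and morphisms of 𝒜.
-- Existence assertions are Σ-types throughout.
record Setting (o ℓ e ι κ : Level) : Set (lsuc (o ⊔ ℓ ⊔ e ⊔ ι ⊔ κ)) where
  c : Level
  c = o ⊔ ℓ ⊔ e ⊔ κ

  field
    𝒜  : Category o ℓ e
    fs : ProperFactorizationSystem 𝒜 c

  open Category 𝒜 public
  open ProperFactorizationSystem fs public

  field
    𝒜₀ : Pred Obj c
    Λ  : CardinalClass ι c
    𝒳  : Pred Obj c

  open CardinalClass Λ public

  -- 𝒳 regarded as an indexing collection.
  𝕏 : Set c
  𝕏 = Σ[ X ∈ Obj ] X ∈ 𝒳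

  ℰ𝒳 : ∀ {A B} → Pred (A ⇒ B) c
  ℰ𝒳 f = f ∈ ℰ × (∀ X → X ∈ 𝒳 → IsProjective X f)

  𝒳-generated : Pred Obj c
  𝒳-generated A = Σ[ X ∈ Obj ] X ∈ 𝒳 × (Σ[ q ∈ X ⇒ A ] q ∈ ℰ)

  field
    Λ-products    : ∀ {I : Set ι} → I ∈ Card → (A : I → Obj) →
                    Σ[ P ∈ Obj ] Σ[ π ∈ (∀ i → P ⇒ A i) ] IsProduct A P π
    𝒜₀-iso        : ∀ {A B} (f : A ⇒ B) → IsIso f → A ∈ 𝒜₀ → B ∈ 𝒜₀
    𝒜₀-products   : ∀ {I : Set ι} → I ∈ Card → (A : I → Obj) →
                    (∀ i → A i ∈ 𝒜₀) →
                    ∀ P (π : ∀ i → P ⇒ A i) → IsProduct A P π → P ∈ 𝒜₀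
    𝒜₀-subobjects : ∀ {A B} (m : A ⇒ B) → m ∈ ℳ → B ∈ 𝒜₀ →
                    A ∈ 𝒳-generated → A ∈ 𝒜₀
    𝒜₀-covers     : ∀ A → A ∈ 𝒜₀ →
                    Σ[ X ∈ Obj ] X ∈ 𝒳 × (Σ[ q ∈ X ⇒ A ] q ∈ ℰ𝒳)

module Equations {o ℓ e ι κ} (S : Setting o ℓ e ι κ) where
  open Setting S

  -- A class of quotients of X is given by the class of all its representing
  -- ℰ-morphisms; Mem-resp makes it a class of quotients up to isomorphism.
  record Equation (X : 𝕏) : Set (lsuc (c ⊔ ι)) where
    field
      Mem        : ∀ {E} → Pred (proj₁ X ⇒ E) c
      Mem-resp   : ∀ {E E′} {q : proj₁ X ⇒ E} {q′ : proj₁ X ⇒ E′} (i : E ⇒ E′) →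
                   IsIso i → q′ ≈ i ∘ q → q ∈ Mem → q′ ∈ Mem
      Mem-ℰ      : ∀ {E} {q : proj₁ X ⇒ E} → q ∈ Mem → q ∈ ℰ
      Mem-𝒜₀     : ∀ {E} {q : proj₁ X ⇒ E} → q ∈ Mem → E ∈ 𝒜₀
      codirected : ∀ {I : Set ι} → I ∈ Card →
                   (E : I → Obj) (q : ∀ i → proj₁ X ⇒ E i) → (∀ i → q i ∈ Mem) →
                   Σ[ L ∈ Obj ] Σ[ b ∈ proj₁ X ⇒ L ]
                     b ∈ Mem × (∀ i → q i FactorsThrough b)
      ℰ𝒳-closed  : ∀ {E E′} {q : proj₁ X ⇒ E} (p : E ⇒ E′) →
                   q ∈ Mem → p ∈ ℰ𝒳 → E′ ∈ 𝒜₀ → p ∘ q ∈ Mem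

  open Equation public

  infix 4 _⊨ₒ_ _≼_ _≼ᵗ_ _⊨_ _⊢₁_ _⊢_

  _⊨ₒ_ : ∀ {X} → Obj → Equation X → Set c
  _⊨ₒ_ {X} A T = ∀ (h : proj₁ X ⇒ A) →
    Σ[ E ∈ Obj ] Σ[ q ∈ proj₁ X ⇒ E ] q ∈ Mem T × h FactorsThrough q

  _≼_ : ∀ {X} → Rel (Equation X) c
  _≼_ {X} T T′ = ∀ {E′} (q′ : proj₁ X ⇒ E′) → q′ ∈ Mem T′ →
    Σ[ E ∈ Obj ] Σ[ q ∈ proj₁ X ⇒ E ] q ∈ Mem T × q′ FactorsThrough q

  record Theory : Set (lsuc (c ⊔ ι)) where
    field
      eq              : ∀ X → Equation X
      subst-invariant : ∀ X Y (h : proj₁ X ⇒ proj₁ Y) {E} (q : proj₁ Y ⇒ E) →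
                        q ∈ Mem (eq Y) →
                        ∀ {C} (p : proj₁ X ⇒ C) → IsCoimage (q ∘ h) p →
                        p ∈ Mem (eq X)
      ℰ𝒳-complete     : ∀ Y {E} (q : proj₁ Y ⇒ E) → q ∈ Mem (eq Y) →
                        Σ[ X ∈ 𝕏 ] Σ[ p ∈ proj₁ X ⇒ E ] p ∈ Mem (eq X) × p ∈ ℰ𝒳

  open Theory public using (eq)

  _≼ᵗ_ : Rel Theory c
  𝒯 ≼ᵗ 𝒯′ = ∀ X → eq 𝒯 X ≼ eq 𝒯′ X

  IsSubstitutionClosure : ∀ {X} → Equation X → Theory → Set (lsuc (c ⊔ ι))
  IsSubstitutionClosure {X} T 𝒯 =
    (T ≼ eq 𝒯 X) × (∀ (𝒯′ : Theory) → T ≼ eq 𝒯′ X → 𝒯 ≼ᵗ 𝒯′)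

  _⊨_ : ∀ {X Y} → Equation X → Equation Y → Set c
  T ⊨ T′ = ∀ A → A ∈ 𝒜₀ → A ⊨ₒ T → A ⊨ₒ T′

  -- Substitution applies to any theory that is a substitution closure of T;
  -- its existence is not presupposed.
  data _⊢₁_ : Rel (Σ 𝕏 Equation) (lsuc (c ⊔ ι)) where
    weakening    : ∀ {X} {T T′ : Equation X} → T′ ≼ T → (X , T) ⊢₁ (X , T′)
    substitution : ∀ {X} {T : Equation X} {T̄ : Theory} →
                   IsSubstitutionClosure T T̄ → ∀ Y → (X , T) ⊢₁ (Y , eq T̄ Y)

  _⊢_ : ∀ {X Y} → Equation X → Equation Y → Set (lsuc (c ⊔ ι))
  _⊢_ {X} {Y} T T′ = Star _⊢₁_ (X , T) (Y , T′)

-- The quotients of Y whose codomain lies in 𝒜₀ and satisfies T form, as Y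
-- varies, the substitution closure of T: the objects of 𝒜₀ satisfying T are
-- closed under 𝒳-generated subobjects, Λ-products and ℰ𝒳-quotients, and in any
-- theory above T the codomains satisfy T by completeness and substitution
-- invariance.  An object of 𝒜₀ satisfying T therefore satisfies this closure
-- (take coimages), while T ⊨ T′ forces T′ ≼ closure Y, so that T′ is obtained by
-- one substitution followed by one weakening.
module Submission where

open import Defs
open import Level using (Level)
open import Data.Product using (Σ-syntax; _×_; _,_; proj₁; proj₂)
open import Function.Base using (case_of_)
open import Function.Bundles using (_⇔_; mk⇔)
open import Relation.Binary.Bundles using (Setoid)
open import Relation.Binary.Construct.Closure.ReflexiveTransitive using (ε; _◅_)
open import Relation.Unary using (_∈_)
import Relation.Binary.Reasoning.Setoid as SetoidReasoning

module _ {o ℓ e ι κ : Level} (S : Setting o ℓ e ι κ) where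
  open Setting S
  open Equations S

  private
    hom : Obj → Obj → Setoid ℓ e
    hom A B = record { Carrier = A ⇒ B ; _≈_ = _≈_ ; isEquivalence = equiv }

    module Hom {A B} = Setoid (hom A B)
    module HomReasoning {A B} = SetoidReasoning (hom A B)
    open HomReasoning

  ∘-congˡ : ∀ {A B C} {f : B ⇒ C} {g g′ : A ⇒ B} → g ≈ g′ → f ∘ g ≈ f ∘ g′
  ∘-congˡ = ∘-resp-≈ Hom.refl

  ∘-congʳ : ∀ {A B C} {f f′ : B ⇒ C} {g : A ⇒ B} → f ≈ f′ → f ∘ g ≈ f′ ∘ g
  ∘-congʳ p = ∘-resp-≈ p Hom.refl

  FactorsThrough-resp : ∀ {X A B} {f f′ : X ⇒ B} {g : X ⇒ A} →
    f′ ≈ f → f FactorsThrough g → f′ FactorsThrough g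
  FactorsThrough-resp f′≈f (k , f≈kg) = k , Hom.trans f′≈f f≈kg

  FactorsThrough-post : ∀ {X A B C} {f : X ⇒ B} {g : X ⇒ A} (k : B ⇒ C) →
    f FactorsThrough g → (k ∘ f) FactorsThrough g
  FactorsThrough-post k (l , f≈lg) =
    k ∘ l , Hom.trans (∘-congˡ f≈lg) (Hom.sym assoc)

  FactorsThrough-trans : ∀ {X A B C} {f : X ⇒ C} {g : X ⇒ B} {h : X ⇒ A} →
    f FactorsThrough g → g FactorsThrough h → f FactorsThrough h
  FactorsThrough-trans (k , f≈kg) g∣h =
    FactorsThrough-resp f≈kg (FactorsThrough-post k g∣h)

  -- The diagonal of the square `k ∘ q ≈ m ∘ h` is the required factor.
  FactorsThrough-cancel-ℳ : ∀ {X A B C} {q : X ⇒ A} {h : X ⇒ B} {m : B ⇒ C} →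
    q ∈ ℰ → m ∈ ℳ → (m ∘ h) FactorsThrough q → h FactorsThrough q
  FactorsThrough-cancel-ℳ q∈ℰ m∈ℳ (k , mh≈kq) =
    case diagonal q∈ℰ m∈ℳ (Hom.sym mh≈kq) of λ where
      (d , (dq≈h , _) , _) → d , Hom.sym dq≈h

  -- The factors of the components pair to `u`; then `f` and `u ∘ g` have the same components, so
  -- they agree by uniqueness.
  FactorsThrough-product : ∀ {i} {I : Set i} {A : I → Obj} {P} {π : ∀ i → P ⇒ A i} →
    IsProduct A P π → ∀ {X B} {f : X ⇒ P} {g : X ⇒ B} →
    (∀ i → (π i ∘ f) FactorsThrough g) → f FactorsThrough g
  FactorsThrough-product {π = π} prod {f = f} {g} πf∣g =
    case prod (λ i → proj₁ (πf∣g i)) of λ where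
      (u , πu≈k , _) →
        case prod (λ i → π i ∘ f) of λ where
          (_ , _ , unique) →
            u , Hom.trans (unique f λ _ → Hom.refl) (Hom.sym (unique (u ∘ g) λ i → begin
              π i ∘ (u ∘ g)         ≈⟨ assoc ⟨
              (π i ∘ u) ∘ g         ≈⟨ ∘-congʳ (πu≈k i) ⟩
              proj₁ (πf∣g i) ∘ g    ≈⟨ proj₂ (πf∣g i) ⟨
              π i ∘ f               ∎))

  ℰ-quotient-generated : ∀ (Y : 𝕏) {E} {q : proj₁ Y ⇒ E} → q ∈ ℰ → E ∈ 𝒳-generated
  ℰ-quotient-generated (Y , Y∈𝒳) {q = q} q∈ℰ = Y , Y∈𝒳 , q , q∈ℰ

  -- What `A ⊨ₒ T` requires of a single morphism `h`; for `h` in `T′` it is also what `T ≼ T′`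
  -- requires.
  Factor : ∀ {X : 𝕏} {A} → Equation X → proj₁ X ⇒ A → Set c
  Factor {X} T h = Σ[ E ∈ Obj ] Σ[ q ∈ proj₁ X ⇒ E ] q ∈ Mem T × h FactorsThrough q

  ≼-Factor : ∀ {X : 𝕏} {T T′ : Equation X} → T ≼ T′ →
    ∀ {A} {h : proj₁ X ⇒ A} → Factor T′ h → Factor T h
  ≼-Factor T≼T′ (_ , q , q∈T′ , h∣q) =
    case T≼T′ q q∈T′ of λ where
      (E , q′ , q′∈T , q∣q′) → E , q′ , q′∈T , FactorsThrough-trans h∣q q∣q′

  module _ {X : 𝕏} (T : Equation X) where

    ⊨ₒ-subobject : ∀ {A B} {m : A ⇒ B} → m ∈ ℳ → B ⊨ₒ T → A ⊨ₒ T
    ⊨ₒ-subobject {m = m} m∈ℳ B⊨T h =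
      case B⊨T (m ∘ h) of λ where
        (E , q , q∈T , mh∣q) →
          E , q , q∈T , FactorsThrough-cancel-ℳ (Mem-ℰ T q∈T) m∈ℳ mh∣q

    -- Each component of `h` factors through its own member of `T`; codirectedness replaces these by
    -- one common `b`.
    ⊨ₒ-product : ∀ {I : Set ι} → I ∈ Card → {A : I → Obj} {P : Obj}
      {π : ∀ i → P ⇒ A i} → IsProduct A P π → (∀ i → A i ⊨ₒ T) → P ⊨ₒ T
    ⊨ₒ-product I∈Λ {π = π} prod A⊨T h =
      case codirected T I∈Λ (λ i → proj₁ (factor i)) (λ i → proj₁ (proj₂ (factor i)))
             (λ i → proj₁ (proj₂ (proj₂ (factor i)))) of λ where
        (L , b , b∈T , q∣b) → L , b , b∈T , FactorsThrough-product prod λ i →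
          FactorsThrough-trans (proj₂ (proj₂ (proj₂ (factor i)))) (q∣b i)
      where
      factor : ∀ i → Factor T (π i ∘ h)
      factor i = A⊨T i (π i ∘ h)

    -- Since `X` is projective with respect to `p`, a morphism into `B` lifts to `A`, where `T`
    -- holds.
    ⊨ₒ-ℰ𝒳-quotient : ∀ {A B} {p : A ⇒ B} → p ∈ ℰ𝒳 → A ⊨ₒ T → B ⊨ₒ T
    ⊨ₒ-ℰ𝒳-quotient {p = p} (_ , proj) A⊨T h =
      case proj (proj₁ X) (proj₂ X) h of λ where
        (g , h≈pg) → case A⊨T g of λ where
          (E , q , q∈T , g∣q) →
            E , q , q∈T , FactorsThrough-resp h≈pg (FactorsThrough-post p g∣q)

    -- The inverse of `f` lies in `ℳ` and makes `B` a subobject of `A`.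
    ⊨ₒ-iso : ∀ {A B} {f : A ⇒ B} → IsIso f → A ⊨ₒ T → B ⊨ₒ T
    ⊨ₒ-iso (f⁻¹ , f⁻¹f≈id , ff⁻¹≈id) =
      ⊨ₒ-subobject (ℳ-iso (_ , ff⁻¹≈id , f⁻¹f≈id))

    closureEquation : ∀ Y → Equation Y
    closureEquation Y = record
      { Mem        = λ {E} q → q ∈ ℰ × E ∈ 𝒜₀ × E ⊨ₒ T
      ; Mem-resp   = λ i iso q′≈iq (q∈ℰ , E∈𝒜₀ , E⊨T) →
          ℰ-resp-≈ (Hom.sym q′≈iq) (ℰ-∘ (ℰ-iso iso) q∈ℰ) ,
          𝒜₀-iso i iso E∈𝒜₀ , ⊨ₒ-iso iso E⊨T
      ; Mem-ℰ      = proj₁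
      ; Mem-𝒜₀     = λ q∈T̄ → proj₁ (proj₂ q∈T̄)
      ; codirected = lowerBound
      ; ℰ𝒳-closed  = λ p (q∈ℰ , _ , E⊨T) p∈ℰ𝒳 E′∈𝒜₀ →
          ℰ-∘ (proj₁ p∈ℰ𝒳) q∈ℰ , E′∈𝒜₀ , ⊨ₒ-ℰ𝒳-quotient p∈ℰ𝒳 E⊨T
      }
      where
      lowerBound : ∀ {I : Set ι} → I ∈ Card →
        (E : I → Obj) (q : ∀ i → proj₁ Y ⇒ E i) →
        (∀ i → q i ∈ ℰ × E i ∈ 𝒜₀ × E i ⊨ₒ T) →
        Σ[ L ∈ Obj ] Σ[ b ∈ proj₁ Y ⇒ L ]
          (b ∈ ℰ × L ∈ 𝒜₀ × L ⊨ₒ T) × (∀ i → q i FactorsThrough b)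
      lowerBound I∈Λ E q q∈T̄ =
        -- The bound is the coimage of the pairing `u` of the `q i`. Its codomain is an
        -- `𝒳`-generated subobject of `P`, so it inherits from `P` both membership in `𝒜₀` and
        -- satisfaction of `T`.
        case Λ-products I∈Λ E of λ where
          (P , π , prod) → case prod q of λ where
            (u , πu≈q , _) → case factorize u of λ where
              (L , b , b∈ℰ , m , m∈ℳ , u≈mb) →
                L , b ,
                ( b∈ℰ
                , 𝒜₀-subobjects m m∈ℳ
                    (𝒜₀-products I∈Λ E (λ i → proj₁ (proj₂ (q∈T̄ i))) P π prod)
                    (ℰ-quotient-generated Y b∈ℰ)
                , ⊨ₒ-subobject m∈ℳ
                    (⊨ₒ-product I∈Λ prod (λ i → proj₂ (proj₂ (q∈T̄ i))))
                ) ,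
                λ i → FactorsThrough-resp (Hom.sym (πu≈q i))
                        (FactorsThrough-post (π i) (m , u≈mb))

    -- As a quotient of `Y`, `C` is `𝒳`-generated, and `m` embeds it into `A`. This serves both
    -- substitution invariance and `⊨ₒ-closure`.
    coimage∈closure : ∀ Y {A C} {h : proj₁ Y ⇒ A} {p : proj₁ Y ⇒ C} →
      A ∈ 𝒜₀ → A ⊨ₒ T → IsCoimage h p → p ∈ Mem (closureEquation Y)
    coimage∈closure Y A∈𝒜₀ A⊨T (p∈ℰ , m , m∈ℳ , _) =
      p∈ℰ , 𝒜₀-subobjects m m∈ℳ A∈𝒜₀ (ℰ-quotient-generated Y p∈ℰ) ,
      ⊨ₒ-subobject m∈ℳ A⊨T

    closure : Theory
    closure = record
      { eq              = closureEquation
      ; subst-invariant = λ Z _ _ _ (_ , E∈𝒜₀ , E⊨T) _ → coimage∈closure Z E∈𝒜₀ E⊨T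
      ; ℰ𝒳-complete     = λ _ {E} _ (_ , E∈𝒜₀ , E⊨T) →
          case 𝒜₀-covers E E∈𝒜₀ of λ where
            (Z , Z∈𝒳 , p , p∈ℰ𝒳) →
              (Z , Z∈𝒳) , p , (proj₁ p∈ℰ𝒳 , E∈𝒜₀ , E⊨T) , p∈ℰ𝒳
      }

    ⊨ₒ-closure : ∀ Y {A} → A ∈ 𝒜₀ → A ⊨ₒ T → A ⊨ₒ closureEquation Y
    ⊨ₒ-closure Y A∈𝒜₀ A⊨T h =
      case factorize h of λ where
        (C , p , coimage@(_ , m , _ , h≈mp)) →
          C , p , coimage∈closure Y A∈𝒜₀ A⊨T coimage , m , h≈mp

    -- Completeness trades `q` for some `p` in `ℰ𝒳` with the same codomain, along which `h` lifts to
    -- `g`. The coimage of `p ∘ g` lies in `eq 𝒯 X` by substitution invariance, hence factors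
    -- through a member of `T`.
    ≼-theory⇒codomain-⊨ₒ : (𝒯 : Theory) → T ≼ eq 𝒯 X →
      ∀ Y {E} {q : proj₁ Y ⇒ E} → q ∈ Mem (eq 𝒯 Y) → E ⊨ₒ T
    ≼-theory⇒codomain-⊨ₒ 𝒯 T≼𝒯 Y q∈𝒯 h =
      case Theory.ℰ𝒳-complete 𝒯 Y _ q∈𝒯 of λ where
        (Z , p , p∈𝒯 , _ , proj) → case proj (proj₁ X) (proj₂ X) h of λ where
          (g , h≈pg) → case factorize (p ∘ g) of λ where
            (C , r , coimage@(_ , m , _ , pg≈mr)) →
              ≼-Factor {T = T} {T′ = eq 𝒯 X} T≼𝒯
                (C , r , Theory.subst-invariant 𝒯 X Z g p p∈𝒯 r coimage ,
                 m , Hom.trans h≈pg pg≈mr)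

    closure-isSubstitutionClosure : IsSubstitutionClosure T closure
    closure-isSubstitutionClosure =
      -- Satisfaction by `E`, tested on the quotient `q` itself, gives the factorization.
      (λ q (_ , _ , E⊨T) → E⊨T q) ,
      λ 𝒯 T≼𝒯 Y {E} q q∈𝒯 →
        E , q ,
        ( Mem-ℰ (eq 𝒯 Y) q∈𝒯 , Mem-𝒜₀ (eq 𝒯 Y) q∈𝒯
        , ≼-theory⇒codomain-⊨ₒ 𝒯 T≼𝒯 Y q∈𝒯 ) ,
        id , Hom.sym identityˡ

    ⊨⇒≼-closure : ∀ {Y} (T′ : Equation Y) → T ⊨ T′ → T′ ≼ closureEquation Y
    ⊨⇒≼-closure T′ T⊨T′ q (_ , E∈𝒜₀ , E⊨T) = T⊨T′ _ E∈𝒜₀ E⊨T q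

  ⊢₁-sound : ∀ {X Y} {T : Equation X} {T′ : Equation Y} →
    (X , T) ⊢₁ (Y , T′) → T ⊨ T′
  ⊢₁-sound {T = T} {T′} (weakening T′≼T) A A∈𝒜₀ A⊨T h =
    ≼-Factor {T = T′} {T′ = T} T′≼T (A⊨T h)
  ⊢₁-sound {T = T} (substitution {T̄ = T̄} (_ , least) Y) A A∈𝒜₀ A⊨T h =
    -- Minimality of `T̄` places it below `closure T`, so factorizations through the latter yield
    -- factorizations through `T̄`.
    ≼-Factor {T = eq T̄ Y} {T′ = closureEquation T Y}
      (least (closure T) (proj₁ (closure-isSubstitutionClosure T)) Y)
      (⊨ₒ-closure T Y A∈𝒜₀ A⊨T h)

  ⊢-sound : ∀ {X Y} {T : Equation X} {T′ : Equation Y} → T ⊢ T′ → T ⊨ T′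
  ⊢-sound ε A _ A⊨T = A⊨T
  ⊢-sound (step ◅ steps) A A∈𝒜₀ A⊨T =
    ⊢-sound steps A A∈𝒜₀ (⊢₁-sound step A A∈𝒜₀ A⊨T)

  ⊢-complete : ∀ {X Y} {T : Equation X} {T′ : Equation Y} → T ⊨ T′ → T ⊢ T′
  ⊢-complete {Y = Y} {T} {T′} T⊨T′ =
    substitution {T = T} {closure T} (closure-isSubstitutionClosure T) Y ◅
    weakening (⊨⇒≼-closure T T′ T⊨T′) ◅ ε

theorem4p4 : ∀ {o ℓ e ι κ : Level} (S : Setting o ℓ e ι κ) →
    let open Setting S
        open Equations S
    in ∀ {X Y : 𝕏} (T : Equation X) (T′ : Equation Y) → (T ⊨ T′) ⇔ (T ⊢ T′)
theorem4p4 S T T′ = mk⇔ (⊢-complete S) (⊢-sound S)
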